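{- For every theory $\Sigma$ and formula $A \Rightarrow B$: $\Sigma \vdash A \Rightarrow B$ if and only if there is a finite $\Sigma' \subseteq \Sigma^{\mathrm{PL}}$ such that $\Sigma' \vdash_\mathcal{R} A \Rightarrow B$, where $\mathcal{R}$ is the deduction system consisting of (Ax) and (Cut).
   Context: $Y$ is a non-empty finite set of attributes and $\mathcal{T}_Y = \{y^i \mid y \in Y, i \in \mathbb{Z}\}$; $M + j = \{y^{i+j} \mid y^i \in M\}$. A formula is $A \Rightarrow B$ with $A,B$ finite subsets of $\mathcal{T}_Y$; a theory is a set of formulas; $\Sigma^{\mathrm{PL}} = \{A+i \Rightarrow B+i \mid A \Rightarrow B \in \Sigma, i \in \mathbb{Z}\}$. Deduction rules (for arbitrary finite $A,B,C,D \subseteq \mathcal{T}_Y$, $i \in \mathbb{Z}$): (Ax) infer $A \cup B \Rightarrow A$; (Cut) from $A \Rightarrow B$ and $B \cup C \Rightarrow D$ infer $A \cup C \Rightarrow D$; (Shf) from $A \Rightarrow B$ infer $A+i \Rightarrow B+i$. For a set of rules $\mathcal{R}$, an $\mathcal{R}$-proof of $A \Rightarrow B$ by $\Sigma$ is a finite sequence of formulas ending with $A \Rightarrow B$ in which each member is in $\Sigma$ or is the conclusion of a rule in $\mathcal{R}$ whose hypotheses occur earlier; $\Sigma \vdash_\mathcal{R} A \Rightarrow B$ means such a proof exists, and $\Sigma \vdash A \Rightarrow B$ denotes $\vdash_\mathcal{R}$ for $\mathcal{R}$ = \{(Ax), (Cut), (Shf)\}. -}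

module Defs where

open import Level using (Level; 0ℓ) renaming (suc to lsuc)
open import Data.Integer using (ℤ; _+_)
open import Data.List using (List; []; _∷_; _++_; _∷ʳ_; map)
open import Data.List.Membership.Propositional using () renaming (_∈_ to _∈ₗ_)
import Data.List.Membership.Setoid as SetoidMembership
open import Data.List.Relation.Binary.BagAndSetEquality using ([_]-Equality; set)
open import Data.List.Relation.Unary.All using (All)
open import Data.Product using (_×_; _,_; ∃-syntax)
open import Data.Product.Relation.Binary.Pointwise.NonDependent using (×-setoid)
open import Data.Sum using (_⊎_)
open import Function using (_⇔_)
open import Relation.Binary.Bundles using (Setoid)
open import Relation.Binary.Definitions using (_Respects_)
open import Relation.Binary.PropositionalEquality using (_≡_)
open import Relation.Unary using (Pred)

private
  variable
    ℓ ℓ′ : Level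
    Y : Set

infixl 6 _∪_ _⊕_ _⊕ᶠ_
infix  5 _⇒_
infix  4 _≈_ _∈ᶠ_ _∈_ _⊆_ _⊢[_]_ _⊢_

-- The pair (y , i) stands for yⁱ.
TimedAttr : Set → Set
TimedAttr Y = Y × ℤ

-- A list represents the finite set of its members: order and repetition are
-- ignored, since formulas are only ever compared by _≈_ below.
FinSet : Set → Set
FinSet Y = List (TimedAttr Y)

_∪_ : FinSet Y → FinSet Y → FinSet Y
_∪_ = _++_

_⊕_ : FinSet Y → ℤ → FinSet Y
M ⊕ j = map (λ (y , i) → y , i + j) M

Formula : Set → Set
Formula Y = FinSet Y × FinSet Y

pattern _⇒_ A B = A , B

formulaSetoid : Set → Setoid 0ℓ 0ℓ
formulaSetoid Y = ×-setoid ([ set ]-Equality (TimedAttr Y)) ([ set ]-Equality (TimedAttr Y))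

_≈_ : Formula Y → Formula Y → Set
_≈_ {Y} = Setoid._≈_ (formulaSetoid Y)

_∈ᶠ_ : Formula Y → List (Formula Y) → Set
_∈ᶠ_ {Y} = SetoidMembership._∈_ (formulaSetoid Y)

_⊕ᶠ_ : Formula Y → ℤ → Formula Y
(A ⇒ B) ⊕ᶠ i = A ⊕ i ⇒ B ⊕ i

-- Respecting _≈_ makes a predicate on representatives a set of formulas.
record Theory (Y : Set) (ℓ : Level) : Set (lsuc ℓ) where
  field
    member : Pred (Formula Y) ℓ
    resp   : member Respects _≈_

open Theory public

_∈_ : Formula Y → Theory Y ℓ → Set ℓ
F ∈ Σ = member Σ F

_⊆_ : Theory Y ℓ → Theory Y ℓ′ → Set _
Σ ⊆ Γ = ∀ F → F ∈ Σ → F ∈ Γ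

Finite : Theory Y ℓ → Set ℓ
Finite Σ = ∃[ Fs ] (∀ F → F ∈ Σ ⇔ F ∈ᶠ Fs)

PL : Theory Y ℓ → Theory Y ℓ
PL {Y} Σ = record
  { member = λ F → ∃[ G ] ∃[ i ] (G ∈ Σ × F ≈ G ⊕ᶠ i)
  ; resp   = λ {F} {F′} F≈F′ (G , i , G∈Σ , F≈G⊕i) →
      G , i , G∈Σ , trans {F′} {F} {G ⊕ᶠ i} (sym {F} {F′} F≈F′) F≈G⊕i
  }
  where open Setoid (formulaSetoid Y) using (sym; trans)

data Rule : Set where
  Ax Cut Shf : Rule

-- Instance r Hs F: the rule r infers F from the hypotheses Hs.
data Instance {Y : Set} : Rule → List (Formula Y) → Formula Y → Set where
  ax  : ∀ A B     → Instance Ax  [] (A ∪ B ⇒ A)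
  cut : ∀ A B C D → Instance Cut ((A ⇒ B) ∷ (B ∪ C ⇒ D) ∷ []) (A ∪ C ⇒ D)
  shf : ∀ A B i   → Instance Shf ((A ⇒ B) ∷ []) (A ⊕ i ⇒ B ⊕ i)

-- Hypotheses are matched up to _≈_ by _∈ᶠ_ and conclusions by F ≈ G, so the
-- rules act on the sets and not on the lists representing them.
Justified : Theory Y ℓ → List Rule → List (Formula Y) → Formula Y → Set ℓ
Justified Σ R earlier F =
  F ∈ Σ ⊎
  (∃[ r ] ∃[ Hs ] ∃[ G ] (r ∈ₗ R × Instance r Hs G × F ≈ G × All (_∈ᶠ earlier) Hs))

IsProof : Theory Y ℓ → List Rule → List (Formula Y) → Set ℓ
IsProof Σ R Fs = ∀ earlier F later → Fs ≡ earlier ++ F ∷ later → Justified Σ R earlier F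

_⊢[_]_ : Theory Y ℓ → List Rule → Formula Y → Set ℓ
Σ ⊢[ R ] F = ∃[ Fs ] IsProof Σ R (Fs ∷ʳ F)

_⊢_ : Theory Y ℓ → Formula Y → Set ℓ
Σ ⊢ F = Σ ⊢[ Ax ∷ Cut ∷ Shf ∷ [] ] F

{-# OPTIONS --safe #-}

-- Every formula derivable from Σ stays derivable, without (Shf) and from PL Σ,
-- after any shift: shifts commute with (Ax) and (Cut), compose with each other,
-- and turn hypotheses from Σ into members of PL Σ. A derivation uses only
-- finitely many hypotheses. Conversely one (Shf) per member of PL Σ suffices.
module Submission where

open import Defs
open import Level using (Level; 0ℓ)
open import Data.Nat using (ℕ; suc)
open import Data.Fin using (Fin)
open import Data.Integer using (ℤ; 0ℤ; _+_)
import Data.Integer.Properties as ℤ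
open import Data.List using (List; []; _∷_; _++_; _∷ʳ_)
import Data.List.Properties as List
import Data.List.Membership.Setoid.Properties as Membership
open import Data.List.Membership.Propositional using () renaming (_∈_ to _∈ₗ_)
open import Data.List.Relation.Binary.BagAndSetEquality using (map-cong)
open import Data.List.Relation.Unary.All as All using (All; []; _∷_)
import Data.List.Relation.Unary.All.Properties as All
open import Data.List.Relation.Unary.Any using (here; there)
open import Data.Product using (_×_; _,_; Σ-syntax; ∃-syntax)
open import Data.Sum using (_⊎_; inj₁; inj₂)
open import Function using (_⇔_; _↔_; mk⇔)
open import Relation.Binary.Bundles using (Setoid)
open import Relation.Binary.PropositionalEquality
  using (_≡_; refl; sym; trans; cong; cong₂; subst)

private
  variable
    ℓ ℓ′ : Level
    Y : Set

-- Equality of formulas and the action of shifts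

≈-sym : (F G : Formula Y) → F ≈ G → G ≈ F
≈-sym {Y} F G = Setoid.sym (formulaSetoid Y) {F} {G}

≈-trans : (F G H : Formula Y) → F ≈ G → G ≈ H → F ≈ H
≈-trans {Y} F G H = Setoid.trans (formulaSetoid Y) {F} {G} {H}

≡⇒≈ : {F G : Formula Y} → F ≡ G → F ≈ G
≡⇒≈ {Y} = Setoid.reflexive (formulaSetoid Y)

⊕ᶠ-cong : (F G : Formula Y) (i : ℤ) → F ≈ G → F ⊕ᶠ i ≈ G ⊕ᶠ i
⊕ᶠ-cong F G i (A≈A′ , B≈B′) =
  map-cong (λ _ → refl) A≈A′ , map-cong (λ _ → refl) B≈B′

-- This law and the action laws below hold for the lists themselves, not merely up to `≈`, so
-- derivations can be carried along them by `subst`.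
⊕-∪ : (A B : FinSet Y) (i : ℤ) → (A ∪ B) ⊕ i ≡ (A ⊕ i) ∪ (B ⊕ i)
⊕-∪ A B i = List.map-++ _ A B

⊕-⊕ : (A : FinSet Y) (i j : ℤ) → A ⊕ i ⊕ j ≡ A ⊕ (i + j)
⊕-⊕ A i j = trans (sym (List.map-∘ A))
  (List.map-cong (λ (y , k) → cong (y ,_) (ℤ.+-assoc k i j)) A)

⊕-identityʳ : (A : FinSet Y) → A ⊕ 0ℤ ≡ A
⊕-identityʳ A = trans
  (List.map-cong (λ (y , k) → cong (y ,_) (ℤ.+-identityʳ k)) A) (List.map-id A)

⊕ᶠ-⊕ᶠ : (F : Formula Y) (i j : ℤ) → F ⊕ᶠ i ⊕ᶠ j ≡ F ⊕ᶠ (i + j)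
⊕ᶠ-⊕ᶠ (A ⇒ B) i j = cong₂ _,_ (⊕-⊕ A i j) (⊕-⊕ B i j)

⊕ᶠ-identityʳ : (F : Formula Y) → F ⊕ᶠ 0ℤ ≡ F
⊕ᶠ-identityʳ (A ⇒ B) = cong₂ _,_ (⊕-identityʳ A) (⊕-identityʳ B)

-- Proof trees, which allow structural recursion where sequences do not. Allowing `F ≈ G` at each
-- conclusion makes the type closed under `≈` without a separate rule.
data Derivation {Y : Set} (Σ : Theory Y ℓ) (R : List Rule) (F : Formula Y) : Set ℓ where
  hyp  : F ∈ Σ → Derivation Σ R F
  rule : ∀ {r Hs} G → r ∈ₗ R → Instance r Hs G → F ≈ G →
         All (Derivation Σ R) Hs → Derivation Σ R F

module _ {Σ : Theory Y ℓ} {R : List Rule} where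

  Derivation-resp : (F G : Formula Y) → F ≈ G → Derivation Σ R F → Derivation Σ R G
  Derivation-resp F G F≈G (hyp F∈Σ)               = hyp (resp Σ {F} {G} F≈G F∈Σ)
  Derivation-resp F G F≈G (rule K r∈R inst F≈K ds) =
    rule K r∈R inst (≈-trans G F K (≈-sym F G F≈G) F≈K) ds

  module _ {Γ : Theory Y ℓ′} {R′ : List Rule}
           (R⊆R′ : ∀ {r} → r ∈ₗ R → r ∈ₗ R′)
           (Γ⊢Σ : ∀ F → F ∈ Σ → Derivation Γ R′ F) where

    -- Grafting: each leaf is replaced by a derivation of it from `Γ`. This covers both weakening of
    -- the theory and the return from `PL Σ` to `Σ`.
    replaceHyps : (F : Formula Y) → Derivation Σ R F → Derivation Γ R′ F
    replaceHypsAll : {Hs : List (Formula Y)} →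
      All (Derivation Σ R) Hs → All (Derivation Γ R′) Hs

    replaceHyps F (hyp F∈Σ)               = Γ⊢Σ F F∈Σ
    replaceHyps F (rule G r∈R inst F≈G ds) =
      rule G (R⊆R′ r∈R) inst F≈G (replaceHypsAll ds)

    replaceHypsAll []                = []
    replaceHypsAll {H ∷ _} (d ∷ ds) = replaceHyps H d ∷ replaceHypsAll ds

-- Proofs as sequences versus derivation trees

-- Locates a chosen member of a concatenated proof in one of the two halves, together with what
-- precedes it there.
++-∷-split : {X : Set} (xs {ys} us : List X) {v : X} {vs : List X} →
  xs ++ ys ≡ us ++ v ∷ vs →
  (∃[ ws ] xs ≡ us ++ v ∷ ws) ⊎ (∃[ ws ] us ≡ xs ++ ws × ys ≡ ws ++ v ∷ vs)
++-∷-split []       us       eq   = inj₂ (us , refl , eq)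
++-∷-split (x ∷ xs) []       refl = inj₁ (xs , refl)
++-∷-split (x ∷ xs) (u ∷ us) eq with List.∷-injective eq
... | refl , eq′ with ++-∷-split xs us eq′
...   | inj₁ (ws , refl)        = inj₁ (ws , refl)
...   | inj₂ (ws , refl , refl) = inj₂ (ws , refl , refl)

module _ {Y : Set} where

  open Setoid (formulaSetoid Y) using () renaming (refl to ≈-refl)

  ∈ᶠ-++⁺ˡ : {F : Formula Y} (Fs Gs : List (Formula Y)) → F ∈ᶠ Fs → F ∈ᶠ (Fs ++ Gs)
  ∈ᶠ-++⁺ˡ _ _ = Membership.∈-++⁺ˡ (formulaSetoid Y)

  ∈ᶠ-++⁺ʳ : {F : Formula Y} (Fs Gs : List (Formula Y)) → F ∈ᶠ Gs → F ∈ᶠ (Fs ++ Gs)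
  ∈ᶠ-++⁺ʳ Fs _ = Membership.∈-++⁺ʳ (formulaSetoid Y) Fs

  ∈ᶠ-resp : {Fs : List (Formula Y)} (F G : Formula Y) → F ≈ G → F ∈ᶠ Fs → G ∈ᶠ Fs
  ∈ᶠ-resp F G F≈G = Membership.∈-resp-≈ (formulaSetoid Y) {x = F} {y = G} F≈G

  -- The member found in the list is only `≈` to `F`, hence the invariance asked of `P`.
  ∈ᶠ-lookup : {P : Formula Y → Set ℓ} → (∀ F G → F ≈ G → P F → P G) →
    {Fs : List (Formula Y)} → All P Fs → (F : Formula Y) → F ∈ᶠ Fs → P F
  ∈ᶠ-lookup P-resp {G ∷ _} (p ∷ _)  F (here F≈G)   = P-resp G F (≈-sym F G F≈G) p
  ∈ᶠ-lookup P-resp         (_ ∷ ps) F (there F∈Fs) = ∈ᶠ-lookup P-resp ps F F∈Fs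

  module _ {Σ : Theory Y ℓ} {R : List Rule} where

    justified⇒derivation : {earlier : List (Formula Y)} (F : Formula Y) →
      All (Derivation Σ R) earlier → Justified Σ R earlier F → Derivation Σ R F
    justified⇒derivation F ds (inj₁ F∈Σ) = hyp F∈Σ
    justified⇒derivation F ds (inj₂ (r , Hs , G , r∈R , inst , F≈G , Hs∈)) =
      rule G r∈R inst F≈G (All.map (λ {H} → ∈ᶠ-lookup Derivation-resp ds H) Hs∈)

    -- Induction on `later`: its head is justified by formulas already known to be derivable, then
    -- moves over to `earlier`.
    allDerivable : (earlier later : List (Formula Y)) → IsProof Σ R (earlier ++ later) →
      All (Derivation Σ R) earlier → All (Derivation Σ R) (earlier ++ later)
    allDerivable earlier []          p ds = All.++⁺ ds []
    allDerivable earlier (F ∷ later) p ds =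
      subst (All _) assoc (allDerivable (earlier ∷ʳ F) later
        (subst (IsProof Σ R) (sym assoc) p)
        (All.∷ʳ⁺ ds (justified⇒derivation F ds (p earlier F later refl))))
      where assoc = List.∷ʳ-++ earlier F later

    ⊢⇒derivation : (F : Formula Y) → Σ ⊢[ R ] F → Derivation Σ R F
    ⊢⇒derivation F (Fs , p) =
      let (_ , d) = All.∷ʳ⁻ (allDerivable [] (Fs ∷ʳ F) p []) in d

    -- Members of `Gs` may cite all of `Fs`, so this serves both for joining two proofs and for
    -- adding one inference.
    IsProof-append : (Fs Gs : List (Formula Y)) → IsProof Σ R Fs →
      (∀ earlier G later → Gs ≡ earlier ++ G ∷ later → Justified Σ R (Fs ++ earlier) G) →
      IsProof Σ R (Fs ++ Gs)
    IsProof-append Fs Gs p q earlier F later eq with ++-∷-split Fs earlier eq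
    ... | inj₁ (ws , eq′)        = p earlier F ws eq′
    ... | inj₂ (ws , refl , eq′) = q ws F later eq′

    Justified-++ˡ : {earlier : List (Formula Y)} (Fs : List (Formula Y)) (F : Formula Y) →
      Justified Σ R earlier F → Justified Σ R (Fs ++ earlier) F
    Justified-++ˡ Fs F (inj₁ F∈Σ) = inj₁ F∈Σ
    Justified-++ˡ {earlier} Fs F (inj₂ (r , Hs , G , r∈R , inst , F≈G , Hs∈)) =
      inj₂ (r , Hs , G , r∈R , inst , F≈G , All.map (λ {H} → ∈ᶠ-++⁺ʳ {H} Fs earlier) Hs∈)

    IsProof-++ : (Fs Gs : List (Formula Y)) →
      IsProof Σ R Fs → IsProof Σ R Gs → IsProof Σ R (Fs ++ Gs)
    IsProof-++ Fs Gs p q = IsProof-append Fs Gs p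
      (λ earlier G later eq → Justified-++ˡ Fs G (q earlier G later eq))

    IsProof-∷ʳ : (Fs : List (Formula Y)) (F : Formula Y) →
      IsProof Σ R Fs → Justified Σ R Fs F → IsProof Σ R (Fs ∷ʳ F)
    IsProof-∷ʳ Fs F p j = IsProof-append Fs (F ∷ []) p λ where
      []           G later refl → subst (λ Es → Justified Σ R Es F) (sym (List.++-identityʳ Fs)) j
      (_ ∷ [])     G later ()
      (_ ∷ _ ∷ _)  G later ()

    derivation⇒⊢ : (F : Formula Y) → Derivation Σ R F → Σ ⊢[ R ] F
    derivations⇒proof : {Hs : List (Formula Y)} → All (Derivation Σ R) Hs →
      ∃[ Fs ] (IsProof Σ R Fs × All (_∈ᶠ Fs) Hs)

    derivation⇒⊢ F (hyp F∈Σ) = [] , IsProof-∷ʳ [] F (λ where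
      []      _ _ ()
      (_ ∷ _) _ _ ()) (inj₁ F∈Σ)
    derivation⇒⊢ F (rule {r} {Hs} G r∈R inst F≈G ds) =
      let (Fs , p , Hs∈) = derivations⇒proof ds
      in  Fs , IsProof-∷ʳ Fs F p (inj₂ (r , Hs , G , r∈R , inst , F≈G , Hs∈))

    derivations⇒proof [] = [] , (λ where
      []      _ _ ()
      (_ ∷ _) _ _ ()) , []
    derivations⇒proof {H ∷ Hs} (d ∷ ds) =
      let (Fs , p)       = derivation⇒⊢ H d
          (Gs , q , Hs∈) = derivations⇒proof ds
          -- The list in `Σ ⊢[ R ] H` omits the final formula; it is restored here because the next
          -- inference cites it.
          Fs′            = Fs ∷ʳ H
      in  Fs′ ++ Gs , IsProof-++ Fs′ Gs p q ,
          ∈ᶠ-++⁺ˡ {H} Fs′ Gs (∈ᶠ-++⁺ʳ {H} Fs (H ∷ []) (here (≈-refl {H}))) ∷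
          All.map (λ {K} → ∈ᶠ-++⁺ʳ {K} Fs′ Gs) Hs∈

-- Compactness

  -- Membership up to `≈` supplies `resp`, and the level is `0ℓ` whatever the level of the theory
  -- that the list is drawn from.
  listTheory : List (Formula Y) → Theory Y 0ℓ
  listTheory Fs = record { member = _∈ᶠ Fs ; resp = λ {F} {G} → ∈ᶠ-resp F G }

  listTheory-finite : (Fs : List (Formula Y)) → Finite (listTheory Fs)
  listTheory-finite Fs = Fs , λ F → mk⇔ (λ F∈ → F∈) (λ F∈ → F∈)

  listTheory-⊆ : (Σ : Theory Y ℓ) (Fs : List (Formula Y)) →
    All (_∈ Σ) Fs → listTheory Fs ⊆ Σ
  listTheory-⊆ Σ Fs = ∈ᶠ-lookup (λ F G → resp Σ {F} {G})

  Derivation-mono : {Σ : Theory Y ℓ} {Γ : Theory Y ℓ′} {R : List Rule} →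
    Σ ⊆ Γ → (F : Formula Y) → Derivation Σ R F → Derivation Γ R F
  Derivation-mono Σ⊆Γ = replaceHyps (λ r∈R → r∈R) (λ F F∈Σ → hyp (Σ⊆Γ F F∈Σ))

  module _ {Σ : Theory Y ℓ} {R : List Rule} where

    -- A tree has finitely many leaves. At a rule the leaf lists of the premises are concatenated
    -- and each premise is weakened to the longer list.
    compact : (F : Formula Y) → Derivation Σ R F →
      ∃[ Fs ] (All (_∈ Σ) Fs × Derivation (listTheory Fs) R F)
    compactAll : {Hs : List (Formula Y)} → All (Derivation Σ R) Hs →
      ∃[ Fs ] (All (_∈ Σ) Fs × All (Derivation (listTheory Fs) R) Hs)

    compact F (hyp F∈Σ) = F ∷ [] , F∈Σ ∷ [] , hyp (here (≈-refl {F}))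
    compact F (rule G r∈R inst F≈G ds) =
      let (Fs , Fs∈Σ , ds′) = compactAll ds
      in  Fs , Fs∈Σ , rule G r∈R inst F≈G ds′

    compactAll [] = [] , [] , []
    compactAll {H ∷ Hs} (d ∷ ds) =
      let (Fs , Fs∈Σ , d′)  = compact H d
          (Gs , Gs∈Σ , ds′) = compactAll ds
      in  Fs ++ Gs , All.++⁺ Fs∈Σ Gs∈Σ ,
          Derivation-mono (λ K → ∈ᶠ-++⁺ˡ {K} Fs Gs) H d′ ∷
          All.map (λ {K} → Derivation-mono (λ L → ∈ᶠ-++⁺ʳ {L} Fs Gs) K) ds′

-- Elimination of (Shf)

AxCut AxCutShf : List Rule
AxCut    = Ax ∷ Cut ∷ []
AxCutShf = Ax ∷ Cut ∷ Shf ∷ []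

AxCut⊆AxCutShf : ∀ {r} → r ∈ₗ AxCut → r ∈ₗ AxCutShf
AxCut⊆AxCutShf (here eq)         = here eq
AxCut⊆AxCutShf (there (here eq)) = there (here eq)

module _ {Y : Set} {Σ : Theory Y ℓ} where

  open Setoid (formulaSetoid Y) using () renaming (refl to ≈-refl)

  -- The induction needs every `i` at once: below a (Shf) by `j` the premise is taken at shift
  -- `j + i`, and the (Shf) node disappears.
  shifted : (F : Formula Y) → Derivation Σ AxCutShf F →
    (i : ℤ) → Derivation (PL Σ) AxCut (F ⊕ᶠ i)
  shifted F (hyp F∈Σ) i = hyp (F , i , F∈Σ , ≈-refl {F ⊕ᶠ i})
  shifted F (rule G _ (ax A B) F≈G []) i =
    rule ((A ⊕ i) ∪ (B ⊕ i) ⇒ A ⊕ i) (here refl) (ax (A ⊕ i) (B ⊕ i))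
      (≈-trans (F ⊕ᶠ i) (G ⊕ᶠ i) _ (⊕ᶠ-cong F G i F≈G)
        (≡⇒≈ (cong (_, A ⊕ i) (⊕-∪ A B i))))
      []
  shifted F (rule G _ (cut A B C D) F≈G (d ∷ e ∷ [])) i =
    rule ((A ⊕ i) ∪ (C ⊕ i) ⇒ D ⊕ i) (there (here refl)) (cut (A ⊕ i) (B ⊕ i) (C ⊕ i) (D ⊕ i))
      (≈-trans (F ⊕ᶠ i) (G ⊕ᶠ i) _ (⊕ᶠ-cong F G i F≈G)
        (≡⇒≈ (cong (_, D ⊕ i) (⊕-∪ A C i))))
      (shifted (A ⇒ B) d i ∷
       -- (Cut) requires the left side to be literally a union whose first part is `B ⊕ i`.
       subst (λ E → Derivation (PL Σ) AxCut (E ⇒ D ⊕ i)) (⊕-∪ B C i) (shifted (B ∪ C ⇒ D) e i) ∷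
       [])
  shifted F (rule G _ (shf A B j) F≈G (d ∷ [])) i =
    Derivation-resp (G ⊕ᶠ i) (F ⊕ᶠ i) (≈-sym (F ⊕ᶠ i) (G ⊕ᶠ i) (⊕ᶠ-cong F G i F≈G))
      (subst (Derivation (PL Σ) AxCut) (sym (⊕ᶠ-⊕ᶠ (A ⇒ B) j i))
        (shifted (A ⇒ B) d (j + i)))

  shf-elim : (F : Formula Y) → Derivation Σ AxCutShf F → Derivation (PL Σ) AxCut F
  shf-elim F d = subst (Derivation (PL Σ) AxCut) (⊕ᶠ-identityʳ F) (shifted F d 0ℤ)

  PL-derivable : (F : Formula Y) → F ∈ PL Σ → Derivation Σ AxCutShf F
  PL-derivable F ((A ⇒ B) , i , G∈Σ , F≈G⊕i) =
    rule _ (there (there (here refl))) (shf A B i) F≈G⊕i (hyp G∈Σ ∷ [])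

theorem9 : {ℓ : Level} (Y : Set) (n : ℕ) → Y ↔ Fin (suc n) →
    (Σ : Theory Y ℓ) (A B : FinSet Y) →
    (Σ ⊢ (A ⇒ B)) ⇔
    (Σ[ Σ′ ∈ Theory Y 0ℓ ] (Finite Σ′ × Σ′ ⊆ PL Σ × Σ′ ⊢[ Ax ∷ Cut ∷ [] ] (A ⇒ B)))
theorem9 Y n Y↔Fin Σ A B = mk⇔
  (λ Σ⊢F →
    let (Fs , Fs∈PL , d) = compact F (shf-elim {Σ = Σ} F (⊢⇒derivation F Σ⊢F))
    in  listTheory Fs , listTheory-finite Fs , listTheory-⊆ (PL Σ) Fs Fs∈PL , derivation⇒⊢ F d)
  (λ (Σ′ , _ , Σ′⊆PL , Σ′⊢F) →
    -- Each leaf from `Σ′` lies in `PL Σ` and becomes a single (Shf) applied to a member of `Σ`.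
    derivation⇒⊢ F (replaceHyps {Σ = Σ′} AxCut⊆AxCutShf
      (λ G G∈Σ′ → PL-derivable {Σ = Σ} G (Σ′⊆PL G G∈Σ′))
      F (⊢⇒derivation F Σ′⊢F)))
  where F = A ⇒ B
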